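{- Let $r\ge 1$ be an integer. If $G$ is a connected graph such that for some positive integer $k$ the graph $D_k(G)$ is connected and $r$-regular, then $|G|\le 2r$. Consequently, the class ${\cal D}_r$ of all $r$-regular connected graphs $H$ for which there exist a connected graph $G$ and a positive integer $k$ with $H\cong D_k(G)$ is finite (up to isomorphism), i.e. $|{\cal D}_r|<\infty$.
   Context: Graphs are finite and simple, with nonempty vertex set; $|G|$ denotes the number of vertices of $G$. A set $S\subseteq V(G)$ is a dominating set of $G$ if every vertex in $V(G)\setminus S$ is adjacent to at least one vertex of $S$. For a positive integer $k$, the $k$-dominating graph $D_k(G)$ is the graph whose vertices are the dominating sets of $G$ of cardinality at most $k$, two of them being adjacent if and only if one is obtained from the other by adding or deleting a single vertex. $\cong$ denotes graph isomorphism. -}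

module Defs where

open import Level using (Level)
open import Data.Bool.Base using (true; false)
import Data.Bool.Properties as Bool
open import Data.Empty using (⊥-elim-irr)
open import Data.Fin.Base using (Fin; zero; suc)
import Data.Fin.Properties as Fin
open import Data.Fin.Properties using (+↔⊎)
open import Data.Fin.Subset using (Subset; inside; outside; _∈_; _∉_; _∪_; _-_; ⁅_⁆; ∣_∣)
open import Data.Fin.Subset.Properties using (_∈?_; x∈⁅x⁆; q⊆p∪q; x∈p⇒∣p-x∣<∣p∣)
open import Data.Irrelevant using ([_])
open import Data.List.Relation.Unary.All using (All)
open import Data.List.Relation.Unary.Any using (Any)
open import Data.Nat.Base using (ℕ; zero; suc; _+_; _≤_)
open import Data.Nat.Properties using (<-irrefl; _≤?_)
open import Data.Product.Base using (∃; ∃-syntax; _×_; _,_; proj₁; proj₂)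
open import Data.Refinement using (Refinement-syntax; _,_; value)
open import Data.Sum.Base using (_⊎_; inj₁; inj₂; swap)
open import Data.Sum.Function.Propositional using (_⊎-↔_)
open import Data.Vec.Base using ([]; _∷_; tabulate)
open import Data.Vec.Properties using (≡-dec)
open import Function.Base using (_∘_)
open import Function.Bundles using (_↔_; _⇔_; mk↔ₛ′; Inverse)
open import Function.Properties.Inverse using (↔-trans; ↔-sym)
open import Relation.Binary.Construct.Closure.ReflexiveTransitive using (Star)
open import Relation.Binary.PropositionalEquality using (_≡_; refl; sym; cong; subst)
open import Relation.Nullary using (¬_; Dec; yes; no; does)
open import Relation.Nullary.Decidable using (map′; ¬?; _×-dec_; _⊎-dec_; _→-dec_)
open import Relation.Unary using (Pred; Decidable)

private
  variable
    ℓ : Level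
    m : ℕ

------------------------------------------------------------------------
-- Finite simple graphs

-- The empty graph is not excluded here, because Dom k G below has no
-- vertices when k is smaller than the domination number of G.
-- Nonemptiness is part of Connected.

record Graph : Set₁ where
  infix 4 _~_ _~?_
  field
    Vertex  : Set
    order   : ℕ
    finite  : Vertex ↔ Fin order
    _~_     : Vertex → Vertex → Set
    _~?_    : ∀ u v → Dec (u ~ v)
    ~-sym   : ∀ {u v} → u ~ v → v ~ u
    ~-irrefl : ∀ {v} → ¬ (v ~ v)

  index : Vertex → Fin order
  index = Inverse.to finite

  vertex : Fin order → Vertex
  vertex = Inverse.from finite

  -- A set of vertices is a subset of Fin order, read through index.
  VertexSet : Set
  VertexSet = Subset order

  infix 4 _∈ᵥ_ _∉ᵥ_
  _∈ᵥ_ _∉ᵥ_ : Vertex → VertexSet → Set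
  v ∈ᵥ S = index v ∈ S
  v ∉ᵥ S = index v ∉ S

  neighbours : Vertex → VertexSet
  neighbours v = tabulate (λ i → does (v ~? vertex i))

  degree : Vertex → ℕ
  degree v = ∣ neighbours v ∣

  vertex-index : ∀ v → vertex (index v) ≡ v
  vertex-index = Inverse.strictlyInverseʳ finite

  any? : {P : Pred Vertex ℓ} → Decidable P → Dec (∃ P)
  any? {P = P} P? =
    map′ (λ (i , p) → vertex i , p)
         (λ (v , p) → index v , subst P (sym (vertex-index v)) p)
         (Fin.any? (P? ∘ vertex))

  all? : {P : Pred Vertex ℓ} → Decidable P → Dec (∀ v → P v)
  all? {P = P} P? =
    map′ (λ f v → subst P (vertex-index v) (f (index v)))
         (λ f i → f (vertex i))
         (Fin.all? (P? ∘ vertex))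

open Graph public using (Vertex; order)

Connected : Graph → Set
Connected G = V × (∀ (u v : V) → Star (Graph._~_ G) u v)
  where V = Vertex G

Regular : ℕ → Graph → Set
Regular r G = ∀ v → Graph.degree G v ≡ r

infix 4 _≅_
record _≅_ (G H : Graph) : Set where
  private
    module G = Graph G
    module H = Graph H
  field
    bijection : Vertex G ↔ Vertex H
  open Inverse bijection public using (to; from)
  field
    adjacency : ∀ u v → (u G.~ v) ⇔ (to u H.~ to v)

------------------------------------------------------------------------
-- A decidable family of subsets of Fin m is finite

private
  split : {P : Pred (Subset (suc m)) ℓ} →
          [ S ∈ Subset (suc m) ∣ P S ] ↔
          ([ S ∈ Subset m ∣ P (inside ∷ S) ] ⊎ [ S ∈ Subset m ∣ P (outside ∷ S) ])
  split = mk↔ₛ′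
    (λ { (true ∷ S , p) → inj₁ (S , p) ; (false ∷ S , p) → inj₂ (S , p) })
    (λ { (inj₁ (S , p)) → inside ∷ S , p ; (inj₂ (S , p)) → outside ∷ S , p })
    (λ { (inj₁ _) → refl ; (inj₂ _) → refl })
    (λ { (true ∷ _ , _) → refl ; (false ∷ _ , _) → refl })

subsets-finite : {P : Pred (Subset m) ℓ} → Decidable P →
                 ∃[ n ] ([ S ∈ Subset m ∣ P S ] ↔ Fin n)
subsets-finite {zero} P? with P? []
... | yes p = 1 , mk↔ₛ′ (λ _ → zero) (λ _ → [] , [ p ])
                        (λ { zero → refl }) (λ { ([] , _) → refl })
... | no ¬p = 0 , mk↔ₛ′ (λ { ([] , [ p ]) → ⊥-elim-irr (¬p p) }) (λ ())
                        (λ ()) (λ { ([] , [ p ]) → ⊥-elim-irr (¬p p) })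
subsets-finite {suc m} P? =
  let a , f = subsets-finite (P? ∘ (inside ∷_))
      b , g = subsets-finite (P? ∘ (outside ∷_))
  in a + b , ↔-trans split (↔-trans (f ⊎-↔ g) (↔-sym +↔⊎))

------------------------------------------------------------------------
-- Dominating sets and k-dominating graphs

module _ (G : Graph) where
  open Graph G

  Dominating : VertexSet → Set
  Dominating S = ∀ v → v ∉ᵥ S → ∃[ u ] u ∈ᵥ S × v ~ u

  dominating? : Decidable Dominating
  dominating? S =
    all? (λ v → ¬? (index v ∈? S) →-dec any? (λ u → (index u ∈? S) ×-dec (v ~? u)))

  -- T is obtained from S by adding or deleting a single vertex.
  ObtainedFrom : VertexSet → VertexSet → Set
  ObtainedFrom S T =
    ∃[ v ] ((v ∉ᵥ S × T ≡ S ∪ ⁅ index v ⁆) ⊎ (v ∈ᵥ S × T ≡ S - index v))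

  obtainedFrom? : ∀ S T → Dec (ObtainedFrom S T)
  obtainedFrom? S T = any? λ v →
    (¬? (index v ∈? S) ×-dec ≡-dec Bool._≟_ T (S ∪ ⁅ index v ⁆)) ⊎-dec
    ((index v ∈? S) ×-dec ≡-dec Bool._≟_ T (S - index v))

  obtainedFrom-irrefl : ∀ {S} → ¬ ObtainedFrom S S
  obtainedFrom-irrefl {S} (v , inj₁ (v∉S , eq)) =
    v∉S (subst (index v ∈_) (sym eq) (q⊆p∪q S _ (x∈⁅x⁆ (index v))))
  obtainedFrom-irrefl (v , inj₂ (v∈S , eq)) =
    <-irrefl (sym (cong ∣_∣ eq)) (x∈p⇒∣p-x∣<∣p∣ v∈S)

-- Vertices carry an irrelevant proof of domination and size, so two of
-- them are equal as soon as the underlying vertex sets are.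

Dom : ℕ → Graph → Graph
Dom k G = record
  { Vertex   = [ S ∈ Graph.VertexSet G ∣ (Dominating G S × ∣ S ∣ ≤ k) ]
  ; order    = proj₁ enumeration
  ; finite   = proj₂ enumeration
  ; _~_      = λ S T → ObtainedFrom G (value S) (value T) ⊎ ObtainedFrom G (value T) (value S)
  ; _~?_     = λ S T → obtainedFrom? G (value S) (value T) ⊎-dec obtainedFrom? G (value T) (value S)
  ; ~-sym    = swap
  ; ~-irrefl = λ { (inj₁ p) → obtainedFrom-irrefl G p ; (inj₂ p) → obtainedFrom-irrefl G p }
  }
  where
  enumeration = subsets-finite (λ S → dominating? G S ×-dec (∣ S ∣ ≤? k))

𝓓 : ℕ → Graph → Set₁
𝓓 r H = Connected H × Regular r H ×
        (∃[ G ] ∃[ k ] Connected G × 1 ≤ k × H ≅ Dom k G)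

-- The list consists of members of the class and meets every isomorphism
-- class in it; repetitions up to isomorphism are harmless.
FiniteUpToIso : (Graph → Set₁) → Set₁
FiniteUpToIso 𝓒 = ∃[ Hs ] All 𝓒 Hs × (∀ H → 𝓒 H → Any (H ≅_) Hs)

{-# OPTIONS --safe #-}

-- Let X be a dominating set with |X| < k, and let Y be the set of vertices v
-- such that X △ {v} is again dominating.  Each v in Y gives a different
-- neighbour of X in D_k(G), so |Y| ≤ r, and Y contains the complement of X,
-- so |G| ≤ |X| + r.  If |X| ≤ r this is the bound.  Otherwise |Y| < k, and Y is
-- itself dominating: when X - v does not dominate, either v has no neighbour in
-- X, so it has one outside X, or v is the only neighbour in X of some vertex
-- outside X.  The same estimate for Y in place of X gives |G| ≤ |Y| + r ≤ 2r.
--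
-- For the finiteness, D_k(G) depends only on G up to isomorphism and on
-- min(k, 2r), so it suffices to filter the finitely many pairs of an adjacency
-- matrix of size at most 2r and a bound k ≤ 2r.

module Submission where

open import Defs
open import Data.Bool.Base using (Bool; true)
import Data.Bool.Properties as Bool
open import Data.Fin.Base using (Fin; zero; suc; combine; remQuot; funToFin; finToFun)
open import Data.Fin.Properties
  using (_≟_; suc-injective; remQuot-combine; finToFun-funToFin; 2↔Bool)
open import Data.Fin.Subset using (Subset; inside; outside; _∈_; _∉_; _⊆_; _∪_; _-_; ∁; ⁅_⁆; ∣_∣)
open import Data.Fin.Subset.Properties
  using (_∈?_; x∈⁅x⁆; x∈⁅y⁆⇒x≡y; p⊆p∪q; q⊆p∪q; x∈p∪q⁻; p─q⊆p; x∈p∧x≢y⇒x∈p-y;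
         x∈p⇒∣p-x∣<∣p∣; p─⊥≡p; p⊆q⇒∣p∣≤∣q∣; p⊂q⇒∣p∣<∣q∣; ∣p∣≤n; ∣∁p∣≡n∸∣p∣; x∈∁p⇒x∉p; Empty-unique; ∣⊥∣≡0)
open import Data.Irrelevant using ([_])
open import Data.List.Base using (List; []; _∷_; map; filter; allFin; upTo; tabulate; concatMap; cartesianProduct)
open import Data.List.Membership.Propositional using (lose) renaming (_∈_ to _∈ˡ_)
open import Data.List.Membership.Propositional.Properties
  using (∈-map⁺; ∈-allFin; ∈-tabulate⁺; ∈-concatMap⁺; ∈-upTo⁺; ∈-filter⁺; ∈-cartesianProduct⁺)
open import Data.List.Relation.Unary.All using (All)
import Data.List.Relation.Unary.All as All
import Data.List.Relation.Unary.All.Properties as All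
open import Data.List.Relation.Unary.Any using (Any; here; there)
import Data.List.Relation.Unary.Any.Properties as Any
open import Data.Nat.Base using (ℕ; suc; _+_; _*_; _^_; _∸_; _⊓_; _≤_; _<_; z≤n; s≤s)
open import Data.Nat.Properties
  using (≤-refl; ≤-reflexive; ≤-trans; ≤-antisym; <-≤-trans; ≤-<-trans; <⇒≤; <-irrefl; ≰⇒>; _≤?_;
         +-mono-≤; +-monoʳ-≤; +-identityʳ; m+[n∸m]≡n; m≤n⇒m≤1+n; m≤n*m; ⊓-glb; m⊓n≤m; m⊓n≤n; module ≤-Reasoning)
  renaming (_≟_ to _≟ⁿ_)
open import Data.Product.Base using (∃-syntax; _×_; _,_; proj₁; proj₂; uncurry)
open import Data.Refinement using (_,_; value; refine)
open import Data.Sum.Base using (_⊎_; inj₁; inj₂)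
import Data.Sum.Base as Sum
open import Data.Vec.Base using ([]; _∷_; here; there) renaming (tabulate to tabulateᵛ)
open import Data.Vec.Properties using (lookup⇒[]=; []=⇒lookup; lookup∘tabulate)
open import Function.Base using (_∘_; id)
open import Function.Bundles using (_⇔_; mk↔ₛ′; mk⇔; Inverse; Injection; Equivalence)
open import Function.Properties.Inverse using (↔-refl; ↔-trans; ↔-sym; ↔⇒↣)
open import Relation.Binary.Construct.Closure.ReflexiveTransitive using (Star; ε; _◅_; _◅◅_; gmap)
open import Relation.Binary.Core using (Rel)
import Relation.Binary.Definitions as B
open import Relation.Binary.PropositionalEquality
  using (_≡_; _≢_; refl; sym; trans; cong; subst; subst₂; module ≡-Reasoning)
open import Relation.Nullary using (yes; no; does; contradiction)
open import Relation.Nullary.Decidable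
  using (map′; ¬?; _×-dec_; _⊎-dec_; dec-true; recompute; decidable-stable)
open import Relation.Unary using (Pred; Decidable)

private
  variable
    m n r : ℕ

-- Finite subsets

module _ {ℓ} {P : Pred (Fin n) ℓ} (P? : Decidable P) {i : Fin n} where

  ∈-tabulate-does⁺ : P i → i ∈ tabulateᵛ (does ∘ P?)
  ∈-tabulate-does⁺ p = lookup⇒[]= i _ (trans (lookup∘tabulate _ i) (dec-true (P? i) p))

  ∈-tabulate-does⁻ : i ∈ tabulateᵛ (does ∘ P?) → P i
  ∈-tabulate-does⁻ i∈ with P? i | trans (sym (lookup∘tabulate (does ∘ P?) i)) ([]=⇒lookup i∈)
  ... | yes p | _  = p
  ... | no _  | ()

-- The map is defined on members only, since a toggled set is a vertex of `Dom k G` only if it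
-- dominates. By induction on `p`: the image of a member is deleted from `q` before the remaining
-- members are treated.
injection⇒∣p∣≤∣q∣ : ∀ (p : Subset m) (q : Subset n) (f : ∀ {i} → i ∈ p → Fin n) →
                    (∀ {i} (i∈p : i ∈ p) → f i∈p ∈ q) →
                    (∀ {i j} (i∈p : i ∈ p) (j∈p : j ∈ p) → f i∈p ≡ f j∈p → i ≡ j) →
                    ∣ p ∣ ≤ ∣ q ∣
injection⇒∣p∣≤∣q∣ [] q f into inj = z≤n
injection⇒∣p∣≤∣q∣ (outside ∷ p) q f into inj =
  injection⇒∣p∣≤∣q∣ p q (f ∘ there) (into ∘ there)
    (λ i∈p j∈p eq → suc-injective (inj (there i∈p) (there j∈p) eq))
injection⇒∣p∣≤∣q∣ (inside ∷ p) q f into inj =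
  ≤-<-trans
    (injection⇒∣p∣≤∣q∣ p (q - f here) (f ∘ there)
      (λ i∈p → x∈p∧x≢y⇒x∈p-y (into (there i∈p))
                 (λ eq → contradiction (inj (there i∈p) here eq) λ ()))
      (λ i∈p j∈p eq → suc-injective (inj (there i∈p) (there j∈p) eq)))
    (x∈p⇒∣p-x∣<∣p∣ (into here))

x∉p-x : ∀ (p : Subset n) x → x ∉ p - x
x∉p-x (_ ∷ p) zero    ()
x∉p-x (_ ∷ p) (suc x) (there x∈) = x∉p-x p x x∈

x∉p⇒∣p∣<∣p∪x∣ : ∀ {p : Subset n} {x} → x ∉ p → ∣ p ∣ < ∣ p ∪ ⁅ x ⁆ ∣
x∉p⇒∣p∣<∣p∪x∣ {p = p} {x} x∉p =
  p⊂q⇒∣p∣<∣q∣ (p⊆p∪q ⁅ x ⁆ , x , q⊆p∪q p ⁅ x ⁆ (x∈⁅x⁆ x) , x∉p)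

∣p∣≤1+∣p-x∣ : ∀ (p : Subset n) x → ∣ p ∣ ≤ suc ∣ p - x ∣
∣p∣≤1+∣p-x∣ (inside  ∷ p) zero    = s≤s (≤-reflexive (cong ∣_∣ (sym (p─⊥≡p p))))
∣p∣≤1+∣p-x∣ (outside ∷ p) zero    = m≤n⇒m≤1+n (≤-reflexive (cong ∣_∣ (sym (p─⊥≡p p))))
∣p∣≤1+∣p-x∣ (inside  ∷ p) (suc x) = s≤s (∣p∣≤1+∣p-x∣ p x)
∣p∣≤1+∣p-x∣ (outside ∷ p) (suc x) = ∣p∣≤1+∣p-x∣ p x

-- Toggling one element of a subset

toggle : Subset n → Fin n → Subset n
toggle p x with x ∈? p
... | yes _ = p - x
... | no  _ = p ∪ ⁅ x ⁆

x∈p⇒x∉toggle : ∀ {p : Subset n} {x} → x ∈ p → x ∉ toggle p x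
x∈p⇒x∉toggle {p = p} {x} x∈p with x ∈? p
... | yes _  = x∉p-x p x
... | no x∉p = contradiction x∈p x∉p

x∉p⇒x∈toggle : ∀ {p : Subset n} {x} → x ∉ p → x ∈ toggle p x
x∉p⇒x∈toggle {p = p} {x} x∉p with x ∈? p
... | yes x∈p = contradiction x∈p x∉p
... | no _    = q⊆p∪q p ⁅ x ⁆ (x∈⁅x⁆ x)

y∈p⇒y∈toggle : ∀ {p : Subset n} {x y} → y ≢ x → y ∈ p → y ∈ toggle p x
y∈p⇒y∈toggle {p = p} {x} y≢x y∈p with x ∈? p
... | yes _ = x∈p∧x≢y⇒x∈p-y y∈p y≢x
... | no _  = p⊆p∪q ⁅ x ⁆ y∈p

y∈toggle⇒y∈p : ∀ {p : Subset n} {x y} → y ≢ x → y ∈ toggle p x → y ∈ p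
y∈toggle⇒y∈p {p = p} {x} y≢x y∈ with x ∈? p
... | yes _ = p─q⊆p p ⁅ x ⁆ y∈
... | no _ with x∈p∪q⁻ p ⁅ x ⁆ y∈
...   | inj₁ y∈p = y∈p
...   | inj₂ y∈x = contradiction (x∈⁅y⁆⇒x≡y x y∈x) y≢x

-- Toggling `x` changes membership at `x` and nowhere else, so for `x ≢ y` the two sets would
-- disagree at `x`.
toggle-injective : ∀ (p : Subset n) {x y} → toggle p x ≡ toggle p y → x ≡ y
toggle-injective p {x} {y} eq with x ≟ y
... | yes x≡y = x≡y
... | no x≢y  =
  contradiction (y∈toggle⇒y∈p x≢y (subst (x ∈_) eq (x∉p⇒x∈toggle x∉p))) x∉p
  where
  x∉p : x ∉ p
  x∉p x∈p = x∈p⇒x∉toggle x∈p (subst (x ∈_) (sym eq) (y∈p⇒y∈toggle x≢y x∈p))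

-- Deleting `x` from the toggled set leaves a subset of `p`, whichever way the toggle went.
∣toggle∣≤1+∣p∣ : ∀ (p : Subset n) x → ∣ toggle p x ∣ ≤ suc ∣ p ∣
∣toggle∣≤1+∣p∣ p x = ≤-trans (∣p∣≤1+∣p-x∣ (toggle p x) x) (s≤s (p⊆q⇒∣p∣≤∣q∣ toggle-x⊆p))
  where
  toggle-x⊆p : toggle p x - x ⊆ p
  toggle-x⊆p {y} y∈ = y∈toggle⇒y∈p {x = x} (λ { refl → x∉p-x (toggle p x) x y∈ }) (p─q⊆p _ ⁅ x ⁆ y∈)

toggle-obtained : ∀ G p v → ObtainedFrom G p (toggle p (Graph.index G v))
toggle-obtained G p v with Graph.index G v ∈? p
... | yes v∈p = v , inj₂ (v∈p , refl)
... | no v∉p  = v , inj₁ (v∉p , refl)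

-- The bound on the order

index-injective : ∀ G {u v} → Graph.index G u ≡ Graph.index G v → u ≡ v
index-injective G = Injection.injective (↔⇒↣ (Graph.finite G))

module _ (G : Graph) where
  open Graph G hiding (order; Vertex)

  -- The set called Y in the outline.
  toggles : VertexSet → VertexSet
  toggles X = tabulateᵛ (λ i → does (dominating? G (toggle X i)))

  ∈-toggles⁺ : ∀ {X i} → Dominating G (toggle X i) → i ∈ toggles X
  ∈-toggles⁺ {X} = ∈-tabulate-does⁺ (λ i → dominating? G (toggle X i))

  ∈-toggles⁻ : ∀ {X i} → i ∈ toggles X → Dominating G (toggle X i)
  ∈-toggles⁻ {X} = ∈-tabulate-does⁻ (λ i → dominating? G (toggle X i))

  -- Toggling an element outside `X` enlarges `X`, and a superset of a dominating set dominates.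
  x∉X⇒x∈toggles : ∀ {X} → Dominating G X → ∀ {i} → i ∉ X → i ∈ toggles X
  x∉X⇒x∈toggles {X} X-dom {i} i∉X = ∈-toggles⁺ λ v v∉ →
    let v∉X = λ v∈X → v∉ (X⊆ v∈X)
        u , u∈X , v~u = X-dom v v∉X
    in u , X⊆ u∈X , v~u
    where
    X⊆ : X ⊆ toggle X i
    X⊆ j∈X = y∈p⇒y∈toggle {x = i} (λ { refl → i∉X j∈X }) j∈X

  toggles-dominating : (∀ v → ∃[ u ] v ~ u) → ∀ {X} → Dominating G X → Dominating G (toggles X)
  toggles-dominating neighbour {X} X-dom v v∉Y
    -- Look for a vertex `w` that the toggled set fails to dominate; without one, `v` would belong
    -- to `toggles X`.
    with any? (λ w → ¬? (index w ∈? X′) ×-dec ¬? (any? (λ u → (index u ∈? X′) ×-dec (w ~? u))))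
    where X′ = toggle X (index v)
  ... | no ¬∃ = contradiction (∈-toggles⁺ X′-dom) v∉Y
    where
    X′-dom : Dominating G (toggle X (index v))
    X′-dom w w∉ = decidable-stable (any? (λ u → (index u ∈? _) ×-dec (w ~? u)))
                    (λ ¬dom → ¬∃ (w , w∉ , ¬dom))
  ... | yes (w , w∉X′ , undominated) with index w ≟ index v
  -- The undominated vertex is `v` itself, so any neighbour of `v` lies outside `X` and hence in
  -- `toggles X`.
  ...   | yes w≡v =
    let u , v~u = neighbour v
        u≢v = λ u≡v → ~-irrefl (subst (v ~_) (index-injective G u≡v) v~u)
        u∉X = λ u∈X → undominated
                (u , y∈p⇒y∈toggle u≢v u∈X , subst (_~ u) (sym (index-injective G w≡v)) v~u)
    in u , x∉X⇒x∈toggles X-dom u∉X , v~u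
  -- Now `w` lies outside `X` too, so `X` dominates it by some `u`. Unless `u` is `v`, it survives
  -- the toggle and still dominates `w`; so `w` is the neighbour of `v` sought.
  ...   | no w≢v with X-dom w (λ w∈X → w∉X′ (y∈p⇒y∈toggle w≢v w∈X))
  ...     | u , u∈X , w~u with index u ≟ index v
  ...       | no u≢v  = contradiction (u , y∈p⇒y∈toggle u≢v u∈X , w~u) undominated
  ...       | yes u≡v = w , x∉X⇒x∈toggles X-dom (λ w∈X → w∉X′ (y∈p⇒y∈toggle w≢v w∈X)) ,
      ~-sym (subst (w ~_) (index-injective G u≡v) w~u)

  order≤∣X∣+∣toggles∣ : ∀ {X} → Dominating G X → order G ≤ ∣ X ∣ + ∣ toggles X ∣
  order≤∣X∣+∣toggles∣ {X} X-dom = begin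
    order G                    ≡⟨ m+[n∸m]≡n (∣p∣≤n X) ⟨
    ∣ X ∣ + (order G ∸ ∣ X ∣)  ≡⟨ cong (∣ X ∣ +_) (∣∁p∣≡n∸∣p∣ X) ⟨
    ∣ X ∣ + ∣ ∁ X ∣            ≤⟨ +-monoʳ-≤ ∣ X ∣ (p⊆q⇒∣p∣≤∣q∣ (x∉X⇒x∈toggles X-dom ∘ x∈∁p⇒x∉p)) ⟩
    ∣ X ∣ + ∣ toggles X ∣      ∎
    where open ≤-Reasoning

  -- Different toggles give different neighbours of `S`; the strict bound on its size leaves room
  -- for a toggle that adds a vertex.
  ∣toggles∣≤degree : ∀ {k} (S : Vertex (Dom k G)) → ∣ value S ∣ < k →
                     ∣ toggles (value S) ∣ ≤ Graph.degree (Dom k G) S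
  ∣toggles∣≤degree {k} S ∣S∣<k =
    injection⇒∣p∣≤∣q∣ (toggles X) (D.neighbours S) (D.index ∘ toggled) adjacent
      (λ i∈ j∈ eq → toggle-injective X (cong value (index-injective (Dom k G) {toggled i∈} {toggled j∈} eq)))
    where
    module D = Graph (Dom k G)
    X = value S
    toggled : ∀ {i} → i ∈ toggles X → Vertex (Dom k G)
    toggled {i} i∈ = toggle X i , [ ∈-toggles⁻ i∈ , ≤-trans (∣toggle∣≤1+∣p∣ X i) ∣S∣<k ]
    adjacent : ∀ {i} (i∈ : i ∈ toggles X) → D.index (toggled i∈) ∈ D.neighbours S
    adjacent {i} i∈ =
      ∈-tabulate-does⁺ (λ j → S D.~? D.vertex j)
        (subst (S D.~_) (sym (D.vertex-index (toggled i∈)))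
          (inj₁ (subst (λ j → ObtainedFrom G X (toggle X j))
                   (Inverse.strictlyInverseˡ finite i) (toggle-obtained G X (vertex i)))))

  1≤degree⇒neighbour : ∀ v → 1 ≤ degree v → ∃[ u ] v ~ u
  1≤degree⇒neighbour v 1≤d with any? (v ~?_)
  ... | yes p = p
  ... | no ¬∃ = contradiction 1≤d (<-irrefl (sym degree≡0))
    where
    degree≡0 : degree v ≡ 0
    degree≡0 = trans (cong ∣_∣ (Empty-unique λ (i , i∈) →
                        ¬∃ (vertex i , ∈-tabulate-does⁻ (λ j → v ~? vertex j) i∈)))
                     (∣⊥∣≡0 (order G))

  -- The two sets differ in size and neither exceeds `k`, so the smaller one stays below `k`.
  smaller-obtained : ∀ {S T k} → ObtainedFrom G S T → ∣ S ∣ ≤ k → ∣ T ∣ ≤ k → ∣ S ∣ < k ⊎ ∣ T ∣ < k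
  smaller-obtained (v , inj₁ (v∉S , refl)) _ ∣T∣≤k = inj₁ (<-≤-trans (x∉p⇒∣p∣<∣p∪x∣ v∉S) ∣T∣≤k)
  smaller-obtained (v , inj₂ (v∈S , refl)) ∣S∣≤k _ = inj₂ (<-≤-trans (x∈p⇒∣p-x∣<∣p∣ v∈S) ∣S∣≤k)

  Dom-edge⇒smaller : ∀ {k} (S T : Vertex (Dom k G)) → Graph._~_ (Dom k G) S T →
                     ∣ value S ∣ < k ⊎ ∣ value T ∣ < k
  Dom-edge⇒smaller {k} (S , [ p ]) (T , [ q ]) S~T
    -- The size bounds are irrelevant inside the vertices; being decidable, they can be recomputed.
    with ∣S∣≤k ← recompute (∣ S ∣ ≤? k) (proj₂ p) | ∣T∣≤k ← recompute (∣ T ∣ ≤? k) (proj₂ q) | S~T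
  ... | inj₁ S→T = smaller-obtained S→T ∣S∣≤k ∣T∣≤k
  ... | inj₂ T→S = Sum.swap (smaller-obtained T→S ∣T∣≤k ∣S∣≤k)

  order≤2*r-of-small : (∀ v → ∃[ u ] v ~ u) → ∀ {r k} → Regular r (Dom k G) →
                       (S : Vertex (Dom k G)) → ∣ value S ∣ < k → order G ≤ 2 * r
  order≤2*r-of-small neighbour {r} {k} regular S@(X , [ p ]) ∣X∣<k =
    subst (order G ≤_) (cong (r +_) (sym (+-identityʳ r))) order≤r+r
    where
    X-dom : Dominating G X
    X-dom = recompute (dominating? G X) (proj₁ p)
    estimate : ∀ (T : Vertex (Dom k G)) → ∣ value T ∣ < k → ∣ toggles (value T) ∣ ≤ r
    estimate T ∣T∣<k = ≤-trans (∣toggles∣≤degree T ∣T∣<k) (≤-reflexive (regular T))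
    ∣Y∣≤r : ∣ toggles X ∣ ≤ r
    ∣Y∣≤r = estimate S ∣X∣<k
    Y-dom : Dominating G (toggles X)
    Y-dom = toggles-dominating neighbour X-dom
    order≤r+r : order G ≤ r + r
    order≤r+r with ∣ X ∣ ≤? r
    ... | yes ∣X∣≤r = ≤-trans (order≤∣X∣+∣toggles∣ X-dom) (+-mono-≤ ∣X∣≤r ∣Y∣≤r)
    ... | no ∣X∣≰r  =
      ≤-trans (order≤∣X∣+∣toggles∣ Y-dom)
              (+-mono-≤ ∣Y∣≤r (estimate (toggles X , [ Y-dom , <⇒≤ ∣Y∣<k ]) ∣Y∣<k))
      where
      -- From `∣ toggles X ∣ ≤ r`, `r < ∣ X ∣` and `∣ X ∣ < k`.
      ∣Y∣<k : ∣ toggles X ∣ < k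
      ∣Y∣<k = ≤-<-trans ∣Y∣≤r (<⇒≤ (≤-<-trans (≰⇒> ∣X∣≰r) ∣X∣<k))

subsingleton⇒n≤1 : ∀ n → (∀ (i j : Fin n) → i ≡ j) → n ≤ 1
subsingleton⇒n≤1 0             _  = z≤n
subsingleton⇒n≤1 1             _  = ≤-refl
subsingleton⇒n≤1 (suc (suc n)) eq = contradiction (eq zero (suc zero)) λ ()

-- Every path starting at an isolated vertex is trivial, so by connectedness such a vertex is the
-- only one.
connected⇒order≤1⊎neighbour : ∀ G → Connected G →
                              order G ≤ 1 ⊎ (∀ v → ∃[ u ] Graph._~_ G v u)
connected⇒order≤1⊎neighbour G (_ , path) with Graph.any? G (λ v → ¬? (Graph.any? G (Graph._~?_ G v)))
... | no ¬∃ = inj₂ λ v → decidable-stable (Graph.any? G (Graph._~?_ G v)) (λ isolated → ¬∃ (v , isolated))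
... | yes (v , isolated) = inj₁ (subsingleton⇒n≤1 (order G) λ i j → trans (sym (i≡v i)) (i≡v j))
  where
  v-alone : ∀ u → Star (Graph._~_ G) v u → v ≡ u
  v-alone _ ε         = refl
  v-alone _ (v~w ◅ _) = contradiction (_ , v~w) isolated
  i≡v : ∀ i → Graph.index G v ≡ i
  i≡v i = trans (cong (Graph.index G) (v-alone (Graph.vertex G i) (path v _)))
                (Inverse.strictlyInverseˡ (Graph.finite G) i)

order≤2*r : ∀ {r k} → 1 ≤ r → ∀ G → Connected G → Connected (Dom k G) → Regular r (Dom k G) →
            order G ≤ 2 * r
order≤2*r {r} {k} 1≤r G G-conn (S , _) regular with connected⇒order≤1⊎neighbour G G-conn
... | inj₁ order≤1 = ≤-trans order≤1 (≤-trans 1≤r (m≤n*m r 2))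
-- As `1 ≤ r`, the vertex `S` has a neighbour `T`; the smaller of the two is the dominating set of
-- size below `k` to start from.
... | inj₂ neighbour with T , S~T ← 1≤degree⇒neighbour (Dom k G) S (subst (1 ≤_) (sym (regular S)) 1≤r)
                     with Dom-edge⇒smaller G S T S~T
...   | inj₁ ∣S∣<k = order≤2*r-of-small G neighbour regular S ∣S∣<k
...   | inj₂ ∣T∣<k = order≤2*r-of-small G neighbour regular T ∣T∣<k

-- Decidability of connectedness

-- The Floyd–Warshall relation: a path from x to y whose inner vertices lie in zs.
module _ {a ℓ} {A : Set a} (R : Rel A ℓ) where

  Through : List A → A → A → Set _
  Through []       x y = x ≡ y ⊎ R x y
  Through (z ∷ zs) x y = Through zs x y ⊎ (Through zs x z × Through zs z y)

  through? : B.DecidableEquality A → B.Decidable R → ∀ zs → B.Decidable (Through zs)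
  through? _≟_ R? []       x y = (x ≟ y) ⊎-dec R? x y
  through? _≟_ R? (z ∷ zs) x y =
    through? _≟_ R? zs x y ⊎-dec (through? _≟_ R? zs x z ×-dec through? _≟_ R? zs z y)

  through-base : ∀ zs {x y} → x ≡ y ⊎ R x y → Through zs x y
  through-base []       p = p
  through-base (z ∷ zs) p = inj₁ (through-base zs p)

  -- If `z` is the head of the list, keep the first path up to its first visit to `z` and the second
  -- from its last. If `z` comes later and both paths visit the head, the loop between these visits
  -- is cut out.
  through-trans : ∀ {zs z x y} → z ∈ˡ zs → Through zs x z → Through zs z y → Through zs x y
  through-trans {zs = w ∷ zs} (here refl) p q = inj₂ (Sum.[ id , proj₁ ] p , Sum.[ id , proj₂ ] q)
  through-trans (there z∈) (inj₁ p)       (inj₁ q)       = inj₁ (through-trans z∈ p q)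
  through-trans (there z∈) (inj₁ p)       (inj₂ (q , s)) = inj₂ (through-trans z∈ p q , s)
  through-trans (there z∈) (inj₂ (p , s)) (inj₁ q)       = inj₂ (p , through-trans z∈ s q)
  through-trans (there z∈) (inj₂ (p , _)) (inj₂ (_ , s)) = inj₂ (p , s)

  through⇒star : ∀ zs {x y} → Through zs x y → Star R x y
  through⇒star []       (inj₁ refl)    = ε
  through⇒star []       (inj₂ x~y)     = x~y ◅ ε
  through⇒star (z ∷ zs) (inj₁ p)       = through⇒star zs p
  through⇒star (z ∷ zs) (inj₂ (p , q)) = through⇒star zs p ◅◅ through⇒star zs q

  star⇒through : ∀ {zs} → (∀ z → z ∈ˡ zs) → ∀ {x y} → Star R x y → Through zs x y
  star⇒through all∈ ε         = through-base _ (inj₁ refl)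
  star⇒through all∈ (x~w ◅ p) =
    through-trans (all∈ _) (through-base _ (inj₂ x~w)) (star⇒through all∈ p)

connected? : Decidable Connected
connected? G =
  -- Nonemptiness, decided by searching for a vertex with a trivially true property.
  map′ (λ (v , _) → v) (λ v → v , refl) (any? (λ v → index v ≟ index v)) ×-dec
  all? (λ u → all? (λ v →
    map′ (through⇒star _~_ vertices) (star⇒through _~_ vertex∈) (through? _~_ _≟ᵥ_ _~?_ vertices u v)))
  where
  open Graph G
  vertices = map vertex (allFin _)
  vertex∈ : ∀ v → v ∈ˡ vertices
  vertex∈ v = subst (_∈ˡ vertices) (vertex-index v) (∈-map⁺ vertex (∈-allFin (index v)))
  _≟ᵥ_ : B.DecidableEquality (Vertex G)
  u ≟ᵥ v = map′ (index-injective G) (cong index) (index u ≟ index v)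

regular? : ∀ r → Decidable (Regular r)
regular? r G = Graph.all? G (λ v → Graph.degree G v ≟ⁿ r)

-- Isomorphism invariance

≅-refl : ∀ {G} → G ≅ G
≅-refl = record { bijection = ↔-refl ; adjacency = λ _ _ → mk⇔ id id }

≅-trans : ∀ {G H K} → G ≅ H → H ≅ K → G ≅ K
≅-trans f g = record
  { bijection = ↔-trans F.bijection G.bijection
  ; adjacency = λ u v → mk⇔
      (Equivalence.to (G.adjacency _ _) ∘ Equivalence.to (F.adjacency u v))
      (Equivalence.from (F.adjacency u v) ∘ Equivalence.from (G.adjacency _ _))
  }
  where
  module F = _≅_ f
  module G = _≅_ g

≅-sym : ∀ {G H} → G ≅ H → H ≅ G
≅-sym {G} {H} f = record
  { bijection = ↔-sym bijection
  ; adjacency = λ u v → mk⇔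
      (λ u~v → Equivalence.from (adjacency (from u) (from v))
        (subst₂ (Graph._~_ H) (sym (to-from u)) (sym (to-from v)) u~v))
      (λ u~v → subst₂ (Graph._~_ H) (to-from u) (to-from v)
        (Equivalence.to (adjacency (from u) (from v)) u~v))
  }
  where
  open _≅_ f
  to-from = Inverse.strictlyInverseˡ bijection

≅-connected : ∀ {G H} → G ≅ H → Connected G → Connected H
≅-connected {G} {H} f (v , path) = to v , λ x y →
  subst₂ (Star (Graph._~_ H)) (to-from x) (to-from y)
    (gmap to (Equivalence.to (adjacency _ _)) (path (from x) (from y)))
  where
  open _≅_ f
  to-from = Inverse.strictlyInverseˡ bijection

-- The isomorphism injects the neighbours of `v` into those of its image. Used for `≅-sym f` as
-- well, this yields equal degrees.
≅-degree≤ : ∀ {G H} (f : G ≅ H) v → Graph.degree G v ≤ Graph.degree H (_≅_.to f v)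
≅-degree≤ {G} {H} f v =
  injection⇒∣p∣≤∣q∣ (G.neighbours v) (H.neighbours (to v)) (λ {i} _ → H.index (to (G.vertex i)))
    (λ {i} i∈ → ∈-tabulate-does⁺ (λ j → to v H.~? H.vertex j)
      (subst (to v H.~_) (sym (H.vertex-index _))
        (Equivalence.to (adjacency v (G.vertex i)) (∈-tabulate-does⁻ (λ j → v G.~? G.vertex j) i∈))))
    (λ {i} {j} _ _ eq → vertex-injective (to-injective (index-injective H eq)))
  where
  module G = Graph G
  module H = Graph H
  open _≅_ f
  to-injective : ∀ {u w} → to u ≡ to w → u ≡ w
  to-injective = Injection.injective (↔⇒↣ bijection)
  vertex-injective : ∀ {i j} → G.vertex i ≡ G.vertex j → i ≡ j
  vertex-injective = Injection.injective (↔⇒↣ (↔-sym G.finite))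

≅-regular : ∀ {G H} → G ≅ H → Regular r G → Regular r H
≅-regular {r} {G} {H} f regular v = ≤-antisym
  (≤-trans (≅-degree≤ (≅-sym f) v) (≤-reflexive (regular (from v))))
  (≤-trans (≤-reflexive (sym (regular (from v))))
           (subst (λ w → Graph.degree G (from v) ≤ Graph.degree H w)
                  (Inverse.strictlyInverseˡ bijection v) (≅-degree≤ f (from v))))
  where open _≅_ f

-- Enumeration of graphs

Matrix : ℕ → Set
Matrix n = Fin n → Fin n → Bool

-- Every matrix gives a graph: asymmetric entries and the diagonal are ignored.
matrixGraph : Matrix n → Graph
matrixGraph {n} M = record
  { Vertex   = Fin n
  ; order    = n
  ; finite   = ↔-refl
  ; _~_      = λ i j → i ≢ j × M i j ≡ true × M j i ≡ true
  ; _~?_     = λ i j → ¬? (i ≟ j) ×-dec (M i j Bool.≟ true) ×-dec (M j i Bool.≟ true)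
  ; ~-sym    = λ (i≢j , p , q) → i≢j ∘ sym , q , p
  ; ~-irrefl = λ (i≢i , _) → i≢i refl
  }

-- Numbering the matrices lets the graphs of a given order be listed with membership up to `≡`,
-- although decoding recovers a matrix only pointwise.
decode : Fin (2 ^ (n * n)) → Matrix n
decode c i j = Inverse.to 2↔Bool (finToFun c (combine i j))

encode : Matrix n → Fin (2 ^ (n * n))
encode {n} M = funToFin (Inverse.from 2↔Bool ∘ uncurry M ∘ remQuot n)

decode-encode : ∀ (M : Matrix n) i j → decode (encode M) i j ≡ M i j
decode-encode {n} M i j = begin
  to (finToFun (encode M) (combine i j))           ≡⟨ cong to (finToFun-funToFin _ (combine i j)) ⟩
  to (from (uncurry M (remQuot n (combine i j))))  ≡⟨ cong (to ∘ from ∘ uncurry M) (remQuot-combine i j) ⟩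
  to (from (M i j))                                ≡⟨ Inverse.strictlyInverseˡ 2↔Bool (M i j) ⟩
  M i j                                            ∎
  where
  open ≡-Reasoning
  open Inverse 2↔Bool using (to; from)

adjacencyMatrix : ∀ G → Matrix (order G)
adjacencyMatrix G i j = does (vertex i ~? vertex j)
  where open Graph G

codedGraph : ∀ n → Fin (2 ^ (n * n)) → Graph
codedGraph n c = matrixGraph {n} (decode c)

-- Its order is definitionally that of G, so that both graphs have the same vertex sets.
canonical : Graph → Graph
canonical G = codedGraph (order G) (encode (adjacencyMatrix G))

-- Dominating graphs of the canonical copy

module _ (G : Graph) where
  open Graph G hiding (order; Vertex)
  private
    C = canonical G
    module C = Graph C
    index-vertex = Inverse.strictlyInverseˡ finite

    A : Matrix (order G)
    A = decode (encode (adjacencyMatrix G))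

    entry⁺ : ∀ {u v} → u ~ v → A (index u) (index v) ≡ true
    entry⁺ {u} {v} u~v = trans (decode-encode (adjacencyMatrix G) (index u) (index v))
      (dec-true (_ ~? _) (subst₂ _~_ (sym (vertex-index u)) (sym (vertex-index v)) u~v))

    entry⁻ : ∀ {i j} → A i j ≡ true → vertex i ~ vertex j
    entry⁻ {i} {j} eq with vertex i ~? vertex j | trans (sym (decode-encode (adjacencyMatrix G) i j)) eq
    ... | yes p | _  = p
    ... | no _  | ()

  canonical-adjacency : ∀ u v → u ~ v ⇔ (index u C.~ index v)
  canonical-adjacency u v = mk⇔
    (λ u~v → (λ eq → ~-irrefl (subst (u ~_) (sym (index-injective G eq)) u~v)) , entry⁺ u~v , entry⁺ (~-sym u~v))
    (λ (_ , p , _) → subst₂ _~_ (vertex-index u) (vertex-index v) (entry⁻ p))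

  ≅-canonical : G ≅ C
  ≅-canonical = record { bijection = finite ; adjacency = canonical-adjacency }

  private
    vertex-∈ : ∀ {S : VertexSet} {i} → i ∈ S → vertex i ∈ᵥ S
    vertex-∈ {S} = subst (_∈ S) (sym (index-vertex _))

    vertex-∉ : ∀ {S : VertexSet} {i} → i ∉ S → vertex i ∉ᵥ S
    vertex-∉ {S} = subst (_∉ S) (sym (index-vertex _))

  canonical-dominating : ∀ S → Dominating G S ⇔ Dominating C S
  canonical-dominating S = mk⇔ dominates⁺ dominates⁻
    where
    dominates⁺ : Dominating G S → Dominating C S
    dominates⁺ dom i i∉S =
      let u , u∈S , v~u = dom (vertex i) (vertex-∉ i∉S)
      in index u , u∈S , subst (C._~ index u) (index-vertex i) (Equivalence.to (canonical-adjacency _ u) v~u)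
    dominates⁻ : Dominating C S → Dominating G S
    dominates⁻ dom v v∉S =
      let j , j∈S , v~j = dom (index v) v∉S
      in vertex j , vertex-∈ j∈S ,
         Equivalence.from (canonical-adjacency v _) (subst (index v C.~_) (sym (index-vertex j)) v~j)

  canonical-obtained : ∀ S T → ObtainedFrom G S T ⇔ ObtainedFrom C S T
  canonical-obtained S T = mk⇔
    (λ (v , p) → index v , p)
    (λ (i , p) → vertex i , subst (λ j → (j ∉ S × T ≡ S ∪ ⁅ j ⁆) ⊎ (j ∈ S × T ≡ S - j)) (sym (index-vertex i)) p)

  -- No vertex set has more than `order G ≤ N` elements, so capping `k` at `N` excludes none. The
  -- bijection fixes the underlying sets.
  Dom-canonical-≅ : ∀ k N → order G ≤ N → Dom k G ≅ Dom (k ⊓ N) C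
  Dom-canonical-≅ k N order≤N = record
    { bijection = mk↔ₛ′ (refine shrink) (refine grow) (λ _ → refl) (λ _ → refl)
    ; adjacency = λ S T → mk⇔
        (Sum.map (Equivalence.to (canonical-obtained _ _)) (Equivalence.to (canonical-obtained _ _)))
        (Sum.map (Equivalence.from (canonical-obtained _ _)) (Equivalence.from (canonical-obtained _ _)))
    }
    where
    shrink : ∀ {S} → Dominating G S × ∣ S ∣ ≤ k → Dominating C S × ∣ S ∣ ≤ k ⊓ N
    shrink {S} (dom , ∣S∣≤k) =
      Equivalence.to (canonical-dominating S) dom , ⊓-glb ∣S∣≤k (≤-trans (∣p∣≤n S) order≤N)
    grow : ∀ {S} → Dominating C S × ∣ S ∣ ≤ k ⊓ N → Dominating G S × ∣ S ∣ ≤ k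
    grow {S} (dom , ∣S∣≤k⊓N) =
      Equivalence.from (canonical-dominating S) dom , ≤-trans ∣S∣≤k⊓N (m⊓n≤m k N)

graphsOfOrder : ℕ → List Graph
graphsOfOrder n = tabulate (codedGraph n)

graphsUpTo : ℕ → List Graph
graphsUpTo N = concatMap graphsOfOrder (upTo (suc N))

canonical∈graphsUpTo : ∀ G {N} → order G ≤ N → canonical G ∈ˡ graphsUpTo N
canonical∈graphsUpTo G order≤N =
  ∈-concatMap⁺ graphsOfOrder (lose (∈-upTo⁺ (s≤s order≤N)) (∈-tabulate⁺ (encode (adjacencyMatrix G))))

-- Finiteness of the class

𝓓-finite : ∀ r → 1 ≤ r → FiniteUpToIso (𝓓 r)
𝓓-finite r 1≤r = map dom chosen , sound , complete
  where
  N = 2 * r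

  dom : Graph × ℕ → Graph
  dom (G , k) = Dom k G

  Good : Pred (Graph × ℕ) _
  Good (G , k) = Connected G × 1 ≤ k × Connected (Dom k G) × Regular r (Dom k G)

  good? : Decidable Good
  good? (G , k) = connected? G ×-dec (1 ≤? k) ×-dec connected? (Dom k G) ×-dec regular? r (Dom k G)

  -- The bounds run from 0 to `N` inclusive; `good?` discards 0.
  candidates = cartesianProduct (graphsUpTo N) (upTo (suc N))

  chosen = filter good? candidates

  sound : All (𝓓 r) (map dom chosen)
  sound = All.map⁺ (All.map
    (λ { {G , k} (G-conn , 1≤k , D-conn , D-reg) → D-conn , D-reg , G , k , G-conn , 1≤k , ≅-refl })
    (All.all-filter good? candidates))

  complete : ∀ H → 𝓓 r H → Any (H ≅_) (map dom chosen)
  complete H (H-conn , H-reg , G , k , G-conn , 1≤k , H≅Dom) =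
    Any.map⁺ (lose (∈-filter⁺ good? (∈-cartesianProduct⁺ (canonical∈graphsUpTo G order≤N)
                                                          (∈-upTo⁺ (s≤s (m⊓n≤n k N))))
                                    (≅-connected (≅-canonical G) G-conn
                                    -- The capped bound `k ⊓ N` stays positive because `N = 2 * r`
                                    -- is at least 1.
                                    , ⊓-glb 1≤k (≤-trans 1≤r (m≤n*m r 2))
                                    , ≅-connected H≅ H-conn , ≅-regular H≅ H-reg))
                   H≅)
    where
    order≤N : order G ≤ N
    order≤N = order≤2*r 1≤r G G-conn (≅-connected H≅Dom H-conn) (≅-regular H≅Dom H-reg)
    H≅ : H ≅ Dom (k ⊓ N) (canonical G)
    H≅ = ≅-trans H≅Dom (Dom-canonical-≅ G k N order≤N)

theorem4p1 : (r : ℕ) → 1 ≤ r →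
    ((G : Graph) → Connected G →
    ∃[ k ] (1 ≤ k × Connected (Dom k G) × Regular r (Dom k G)) →
    order G ≤ 2 * r)
    × FiniteUpToIso (𝓓 r)
theorem4p1 r 1≤r =
  (λ G G-conn (k , _ , D-conn , D-reg) → order≤2*r 1≤r G G-conn D-conn D-reg) , 𝓓-finite r 1≤r
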